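{- If computability is stable over the field $\langle K,+,\times\rangle$, and the field $\langle L,+,\times\rangle$ is an extension of finite degree of $\langle K,+,\times\rangle$, then computability is stable over the structure $\langle K,L,+,\times,+,.,\times\rangle$.
   Context: Computability over natural numbers is the usual one. A set $A \subseteq \mathbb{N}$ is effectively enumerable if it is empty or the image of a total computable function from $\mathbb{N}$ to $\mathbb{N}$. For $A \subseteq \mathbb{N}^m$ and $B \subseteq \mathbb{N}$, a computable function from $A$ to $B$ is a partial computable function that is defined at every element of $A$ and takes values in $B$ there. Indexing: an indexing of a set $E$ is a partial function $i$ from $\mathbb{N}$ to $E$ such that $dom(i)$ is effectively enumerable, $i$ is surjective, and there is a computable function $eq$ from $dom(i)\times dom(i)$ to $\{0,1\}$ with $eq(x,y)=1$ if $i(x)=i(y)$ and $eq(x,y)=0$ otherwise. An indexing of a family of sets $E_1,\ldots,E_n$ is a family $i_1,\ldots,i_n$ of indexings of $E_1,\ldots,E_n$. Computable function: given sets $E_1,\ldots,E_m,E_{m+1}$ with indexings $i_1,\ldots,i_{m+1}$, a function $f: E_1\times\ldots\times E_m \to E_{m+1}$ is computable relatively to this indexing if there is a computable function $\hat f$ from $dom(i_1)\times\ldots\times dom(i_m)$ to $dom(i_{m+1})$ such that $i_{m+1}(\hat f(x_1,\ldots,x_m)) = f(i_1(x_1),\ldots,i_m(x_m))$ for all $x_k \in dom(i_k)$. Admissible indexing: a structure $\langle E_1,\ldots,E_n,op_1,\ldots,op_p\rangle$ consists of sets $E_1,\ldots,E_n$ and operations, each from a product of some of these sets to one of these sets. An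 indexing of it is an indexing of $E_1,\ldots,E_n$; it is admissible if every $op_k$ is computable relatively to the indexings of its domains and co-domain. Stable computability: computability is stable over $\langle E_1,\ldots,E_n,op_1,\ldots,op_p\rangle$ if there exists an admissible indexing of this structure and, for all admissible indexings $j_1,\ldots,j_n$ and $j'_1,\ldots,j'_n$ of it, there exist computable functions $h_k$ from $dom(j'_k)$ to $dom(j_k)$ such that $j'_k = j_k\circ h_k$, for $k=1,\ldots,n$. The two-sorted structure $\langle K,L,+,\times,+,.,\times\rangle$ has as operations the addition and multiplication of $K$, the addition of $L$, the product $.$ of an element of $L$ by an element of $K$, and the multiplication of $L$. -}

module Defs where

open import Level using (0ℓ; _⊔_) renaming (suc to lsuc)
open import Algebra.Bundles using (CommutativeRing)
open import Algebra.Morphism.Structures using (IsRingMonomorphism)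
import Algebra.Definitions as AlgebraDefinitions
import Algebra.Properties.CommutativeMonoid.Sum as Sum
open import Data.Fin.Base using (Fin; zero; suc)
open import Data.Nat.Base using (ℕ; zero; suc; _<_)
open import Data.Product.Base using (Σ-syntax; ∃-syntax; _×_)
open import Data.Sum.Base using (_⊎_)
open import Data.Vec.Base using (Vec; []; _∷_; lookup)
open import Data.Vec.Relation.Binary.Pointwise.Inductive using (Pointwise)
open import Data.Vec.Relation.Unary.All using (All; []; _∷_)
open import Function.Bundles using (_⇔_)
open import Relation.Binary.Bundles using (Setoid)
open import Relation.Binary.PropositionalEquality.Core using (_≡_)
open import Relation.Nullary.Negation.Core using (¬_)
open import Relation.Unary using (Pred; U; Empty)

-- The model of computation is that of μ-recursive functions: programs for
-- partial functions from ℕⁿ to ℕ, with a big-step semantics.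

data Code : ℕ → Set where
  Z    : ∀ {n} → Code n
  S    : Code 1
  π    : ∀ {n} → Fin n → Code n
  comp : ∀ {m n} → Code m → Vec (Code n) m → Code n
  rec  : ∀ {n} → Code n → Code (suc (suc n)) → Code (suc n)
  μ    : ∀ {n} → Code (suc n) → Code n

infix 4 _⟨_⟩⇓_

data _⟨_⟩⇓_ : ∀ {n} → Code n → Vec ℕ n → ℕ → Set where
  ⇓Z    : ∀ {n} {xs : Vec ℕ n} → Z ⟨ xs ⟩⇓ 0
  ⇓S    : ∀ {x} → S ⟨ x ∷ [] ⟩⇓ suc x
  ⇓π    : ∀ {n} {xs : Vec ℕ n} (k : Fin n) → π k ⟨ xs ⟩⇓ lookup xs k
  ⇓comp : ∀ {m n} {f : Code m} {gs : Vec (Code n) m} {xs ys z} →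
          Pointwise (λ g y → g ⟨ xs ⟩⇓ y) gs ys →
          f ⟨ ys ⟩⇓ z →
          comp f gs ⟨ xs ⟩⇓ z
  ⇓rec0 : ∀ {n} {f : Code n} {g : Code (suc (suc n))} {xs y} →
          f ⟨ xs ⟩⇓ y →
          rec f g ⟨ zero ∷ xs ⟩⇓ y
  ⇓rec+ : ∀ {n} {f : Code n} {g : Code (suc (suc n))} {x xs y z} →
          rec f g ⟨ x ∷ xs ⟩⇓ y →
          g ⟨ x ∷ y ∷ xs ⟩⇓ z →
          rec f g ⟨ suc x ∷ xs ⟩⇓ z
  ⇓μ    : ∀ {n} {f : Code (suc n)} {xs y} →
          f ⟨ y ∷ xs ⟩⇓ 0 →
          (∀ {z} → z < y → ∃[ k ] f ⟨ z ∷ xs ⟩⇓ suc k) →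
          μ f ⟨ xs ⟩⇓ y

-- A computable function from A ⊆ ℕᵐ to B ⊆ ℕ.  Nothing is required of the
-- program outside A.

record ComputableFunction {m : ℕ} (A : Pred (Vec ℕ m) 0ℓ) (B : Pred ℕ 0ℓ) : Set where
  field
    code    : Code m
    value   : ∀ xs → A xs → ℕ
    value∈B : ∀ xs (a : A xs) → B (value xs a)
    halts   : ∀ xs (a : A xs) → code ⟨ xs ⟩⇓ value xs a

open ComputableFunction public

EffectivelyEnumerable : Pred ℕ 0ℓ → Set
EffectivelyEnumerable A =
  Empty A ⊎
  (Σ[ f ∈ ComputableFunction {1} U U ]
     ∀ y → A y ⇔ (∃[ x ] value f (x ∷ []) _ ≡ y))

∏ : ∀ {m} → (Fin m → Pred ℕ 0ℓ) → Pred (Vec ℕ m) 0ℓ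
∏ A xs = ∀ k → A k (lookup xs k)

-- The equality of the indexed set is the one of the setoid.  A partial
-- function ℕ ⇀ E is a domain together with a map on it which does not depend
-- on the proof of membership.

record Indexing {c ℓ} (E : Setoid c ℓ) : Set (lsuc 0ℓ ⊔ c ⊔ ℓ) where
  open Setoid E using (Carrier; _≈_)
  field
    dom            : Pred ℕ 0ℓ
    index          : ∀ x → dom x → Carrier
    index-unique   : ∀ x (d d′ : dom x) → index x d ≈ index x d′
    dom-enumerable : EffectivelyEnumerable dom
    surjective     : ∀ e → ∃[ x ] Σ[ d ∈ dom x ] index x d ≈ e
    eq             : ComputableFunction {2} (All dom) (λ b → b ≡ 0 ⊎ b ≡ 1)
    eq-correct     : ∀ x y (dx : dom x) (dy : dom y) →
                     let b = value eq (x ∷ y ∷ []) (dx ∷ dy ∷ []) in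
                     (index x dx ≈ index y dy × b ≡ 1) ⊎
                     (¬ index x dx ≈ index y dy × b ≡ 0)

open Indexing public

module _ {c ℓ} {n : ℕ} (E : Fin n → Setoid c ℓ) where

  private
    module E s = Setoid (E s)

  record Operation : Set (c ⊔ ℓ) where
    field
      arity  : ℕ
      source : Fin arity → Fin n
      target : Fin n
      op     : (∀ k → E.Carrier (source k)) → E.Carrier target
      cong   : ∀ {xs ys} → (∀ k → E._≈_ (source k) (xs k) (ys k)) →
               E._≈_ target (op xs) (op ys)

  module _ (i : ∀ s → Indexing (E s)) (o : Operation) where
    open Operation o

    ComputableRelativelyTo : Set ℓ
    ComputableRelativelyTo =
      Σ[ f̂ ∈ ComputableFunction (∏ (λ k → dom (i (source k)))) (dom (i target)) ]
        ∀ xs (d : ∏ (λ k → dom (i (source k))) xs) →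
          E._≈_ target
            (index (i target) (value f̂ xs d) (value∈B f̂ xs d))
            (op (λ k → index (i (source k)) (lookup xs k) (d k)))

  binary : ∀ a b t (_∙_ : E.Carrier a → E.Carrier b → E.Carrier t) →
           (∀ {x x′ y y′} → E._≈_ a x x′ → E._≈_ b y y′ →
            E._≈_ t (x ∙ y) (x′ ∙ y′)) →
           Operation
  binary a b t _∙_ ∙-cong = record
    { arity  = 2
    ; source = lookup (a ∷ b ∷ [])
    ; target = t
    ; op     = λ xs → xs zero ∙ xs (suc zero)
    ; cong   = λ eqs → ∙-cong (eqs zero) (eqs (suc zero))
    }

record Structure c ℓ : Set (lsuc (c ⊔ ℓ)) where
  field
    sorts      : ℕ
    carrier    : Fin sorts → Setoid c ℓ
    ops        : ℕ
    operation  : Fin ops → Operation carrier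

module _ {c ℓ} (M : Structure c ℓ) where
  open Structure M

  StructureIndexing : Set (lsuc 0ℓ ⊔ c ⊔ ℓ)
  StructureIndexing = ∀ s → Indexing (carrier s)

  Admissible : StructureIndexing → Set ℓ
  Admissible i = ∀ o → ComputableRelativelyTo carrier i (operation o)

  Stable : Set (lsuc 0ℓ ⊔ c ⊔ ℓ)
  Stable =
    (∃[ i ] Admissible i) ×
    (∀ j j′ → Admissible j → Admissible j′ → ∀ s →
       Σ[ h ∈ ComputableFunction {1} (All (dom (j′ s))) (dom (j s)) ]
         ∀ x (d : dom (j′ s) x) →
           Setoid._≈_ (carrier s)
             (index (j′ s) x d)
             (index (j s) (value h (x ∷ []) (d ∷ [])) (value∈B h (x ∷ []) (d ∷ []))))

-- Unlike the library's HeytingField, no apartness relation is part of the data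
-- and every element different from 0# is invertible.

record Field c ℓ : Set (lsuc (c ⊔ ℓ)) where
  field
    commutativeRing : CommutativeRing c ℓ
  open CommutativeRing commutativeRing public
  open AlgebraDefinitions _≈_ using (Invertible)
  field
    1≉0        : ¬ 1# ≈ 0#
    invertible : ∀ x → ¬ x ≈ 0# → Invertible 1# _*_ x

record FieldExtension {c ℓ} (K L : Field c ℓ) : Set (c ⊔ ℓ) where
  private
    module K = Field K
    module L = Field L
  field
    embed              : K.Carrier → L.Carrier
    isRingMonomorphism : IsRingMonomorphism K.rawRing L.rawRing embed
  open IsRingMonomorphism isRingMonomorphism public

  infixr 7 _·_
  _·_ : K.Carrier → L.Carrier → L.Carrier
  a · x = embed a L.* x

  open Sum L.+-commutativeMonoid using (sum)

  LinearlyIndependent : ∀ {n} → (Fin n → L.Carrier) → Set (c ⊔ ℓ)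
  LinearlyIndependent {n} b =
    ∀ (a : Fin n → K.Carrier) → sum (λ k → a k · b k) L.≈ L.0# → ∀ k → a k K.≈ K.0#

  Spanning : ∀ {n} → (Fin n → L.Carrier) → Set (c ⊔ ℓ)
  Spanning {n} b =
    ∀ x → Σ[ a ∈ (Fin n → K.Carrier) ] x L.≈ sum (λ k → a k · b k)

  FiniteDegree : Set (c ⊔ ℓ)
  FiniteDegree =
    ∃[ n ] Σ[ b ∈ (Fin n → L.Carrier) ] LinearlyIndependent b × Spanning b

fieldStructure : ∀ {c ℓ} → Field c ℓ → Structure c ℓ
fieldStructure {c} {ℓ} K = record
  { sorts     = 1
  ; carrier   = E
  ; ops       = 2
  ; operation = lookup
      ( binary E zero zero zero K._+_ K.+-cong
      ∷ binary E zero zero zero K._*_ K.*-cong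
      ∷ [])
  }
  where
  module K = Field K
  E : Fin 1 → Setoid c ℓ
  E _ = K.setoid

extensionStructure : ∀ {c ℓ} {K L : Field c ℓ} → FieldExtension K L → Structure c ℓ
extensionStructure {c} {ℓ} {K} {L} ext = record
  { sorts     = 2
  ; carrier   = E
  ; ops       = 5
  ; operation = lookup
      ( binary E k k k K._+_ K.+-cong
      ∷ binary E k k k K._*_ K.*-cong
      ∷ binary E l l l L._+_ L.+-cong
      ∷ binary E k l l _·_ (λ a≈a′ x≈x′ → L.*-cong (⟦⟧-cong a≈a′) x≈x′)
      ∷ binary E l l l L._*_ L.*-cong
      ∷ [])
  }
  where
  module K = Field K
  module L = Field L
  open FieldExtension ext using (_·_; ⟦⟧-cong)
  k l : Fin 2
  k = zero
  l = suc zero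
  E : Fin 2 → Setoid c ℓ
  E zero       = K.setoid
  E (suc zero) = L.setoid

{-# OPTIONS --safe #-}
-- Fix a basis b of L over K.  Fixing an enumeration of the names of elements
-- of K and a computable enumeration of ℕⁿ, every number z denotes the element
-- ∑ₖ aₖ · bₖ of L whose coordinates are the elements of K named by the
-- components of z.  A name of an element with given coordinates is found by
-- unbounded search, equality being decidable coordinatewise; hence + and · are
-- computable, and × reduces to them through fixed names of the products
-- bₖ * bₗ.
--
-- For stability, let j and j′ be two admissible indexings.  From a j′-name of
-- x, search for coordinates aₖ with x ≈ ∑ₖ aₖ · bₖ, computing the right side in
-- j′.  Translate the names of the aₖ by the stability of K and compute the same
-- linear combination in j.
module Submission where

open import Defs
open import Level using (Level; 0ℓ; _⊔_) renaming (suc to lsuc)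
import Algebra.Properties.AbelianGroup as AbelianGroupProperties
import Algebra.Properties.Semiring.Sum as SemiringSum
open import Data.Empty using (⊥-elim)
open import Data.Fin.Base using (Fin; zero; suc)
open import Data.Nat.Base using (ℕ; zero; suc; pred; _+_; _∸_; _≤_; _<_; s≤s⁻¹)
open import Data.Nat.Properties using (≤-refl; <⇒≤; n∸n≡0; m≤m+n; m+n∸n≡m; m+n∸m≡n; m≤n⇒m∸n≡0; m<n⇒0<n∸m; m≤n⇒m<n∨m≡n; +-monoˡ-<; pred[m∸n]≡m∸[1+n])
open import Data.Product.Base using (Σ-syntax; ∃; ∃-syntax; _×_; _,_; proj₁; proj₂)
open import Data.Sum.Base using (_⊎_; inj₁; inj₂; [_,_]′)
open import Data.Unit.Base using (tt)
open import Data.Vec.Base using (Vec; []; _∷_; lookup; tabulate; head; tail)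
open import Data.Vec.Properties using (tabulate∘lookup)
open import Data.Vec.Relation.Binary.Pointwise.Inductive using (Pointwise; []; _∷_; tabulate⁺)
open import Data.Vec.Relation.Unary.All using (All; []; _∷_)
open import Data.Vec.Relation.Unary.All.Properties using (lookup⁺)
open import Function.Base using (_∘_)
open import Function.Bundles using (Equivalence; mk⇔)
open import Relation.Binary.Bundles using (Setoid)
open import Relation.Binary.PropositionalEquality using (_≡_; refl; sym; trans; cong; subst)
import Relation.Binary.Reasoning.Setoid as SetoidReasoning
open import Relation.Nullary using (¬_)
open import Relation.Unary using (Pred; U)

private
  variable
    c ℓ p : Level
    m n : ℕ

-- Elementary recursive programs

const-code : ℕ → Code n
const-code zero    = Z
const-code (suc k) = comp S (const-code k ∷ [])

const-computes : ∀ k (xs : Vec ℕ n) → const-code k ⟨ xs ⟩⇓ k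
const-computes zero    xs = ⇓Z
const-computes (suc k) xs = ⇓comp (const-computes k xs ∷ []) ⇓S

not-code : Code 1
not-code = rec (const-code 1) Z

not-0 : not-code ⟨ 0 ∷ [] ⟩⇓ 1
not-0 = ⇓rec0 (const-computes 1 [])

not-1 : not-code ⟨ 1 ∷ [] ⟩⇓ 0
not-1 = ⇓rec+ not-0 ⇓Z

infixr 6 _and_
_and_ : ℕ → ℕ → ℕ
zero  and y = 0
suc _ and y = y

and-code : Code 2
and-code = rec Z (π (suc (suc zero)))

and-computes : ∀ x y → and-code ⟨ x ∷ y ∷ [] ⟩⇓ x and y
and-computes zero    y = ⇓rec0 ⇓Z
and-computes (suc x) y = ⇓rec+ (and-computes x y) (⇓π _)

+-code : Code 2
+-code = rec (π zero) (comp S (π (suc zero) ∷ []))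

+-computes : ∀ x y → +-code ⟨ x ∷ y ∷ [] ⟩⇓ x + y
+-computes zero    y = ⇓rec0 (⇓π zero)
+-computes (suc x) y = ⇓rec+ (+-computes x y) (⇓comp (⇓π _ ∷ []) ⇓S)

pred-code : Code 1
pred-code = rec Z (π zero)

pred-computes : ∀ x → pred-code ⟨ x ∷ [] ⟩⇓ pred x
pred-computes zero    = ⇓rec0 ⇓Z
pred-computes (suc x) = ⇓rec+ (pred-computes x) (⇓π zero)

-- `rec` recurses on its first argument, whereas truncated subtraction recurses on the subtrahend;
-- hence the swapped order, undone in `∸-code`.
flipped-∸-code : Code 2
flipped-∸-code = rec (π zero) (comp pred-code (π (suc zero) ∷ []))

flipped-∸-computes : ∀ y x → flipped-∸-code ⟨ y ∷ x ∷ [] ⟩⇓ x ∸ y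
flipped-∸-computes zero    x = ⇓rec0 (⇓π zero)
flipped-∸-computes (suc y) x = subst (flipped-∸-code ⟨ suc y ∷ x ∷ [] ⟩⇓_) (pred[m∸n]≡m∸[1+n] x y)
  (⇓rec+ (flipped-∸-computes y x) (⇓comp (⇓π _ ∷ []) (pred-computes (x ∸ y))))

∸-code : Code 2
∸-code = comp flipped-∸-code (π (suc zero) ∷ π zero ∷ [])

∸-computes : ∀ x y → ∸-code ⟨ x ∷ y ∷ [] ⟩⇓ x ∸ y
∸-computes x y = ⇓comp (⇓π _ ∷ ⇓π _ ∷ []) (flipped-∸-computes y x)

-- Enumerating ℕⁿ

triangular : ℕ → ℕ
triangular zero    = 0
triangular (suc k) = suc k + triangular k

triangular-code : Code 1
triangular-code = rec Z (comp +-code (comp S (π zero ∷ []) ∷ π (suc zero) ∷ []))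

triangular-computes : ∀ k → triangular-code ⟨ k ∷ [] ⟩⇓ triangular k
triangular-computes zero    = ⇓rec0 ⇓Z
triangular-computes (suc k) = ⇓rec+ (triangular-computes k)
  (⇓comp (⇓comp (⇓π zero ∷ []) ⇓S ∷ ⇓π _ ∷ []) (+-computes (suc k) (triangular k)))

-- The largest r with triangular r ≤ z: the summand before r is 1 precisely when
-- triangular (suc r) ≤ suc z.
row : ℕ → ℕ
row zero    = 0
row (suc z) = (1 ∸ (triangular (suc (row z)) ∸ suc z)) + row z

row-code : Code 1
row-code = rec Z
  (comp +-code
    ( comp ∸-code
        ( const-code 1
        ∷ comp ∸-code
            ( comp triangular-code (comp S (π (suc zero) ∷ []) ∷ [])
            ∷ comp S (π zero ∷ [])
            ∷ [])
        ∷ [])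
    ∷ π (suc zero)
    ∷ []))

row-computes : ∀ z → row-code ⟨ z ∷ [] ⟩⇓ row z
row-computes zero    = ⇓rec0 ⇓Z
row-computes (suc z) = ⇓rec+ (row-computes z)
  (⇓comp
    ( ⇓comp
        ( const-computes 1 _
        ∷ ⇓comp
            ( ⇓comp (⇓comp (⇓π _ ∷ []) ⇓S ∷ []) (triangular-computes (suc (row z)))
            ∷ ⇓comp (⇓π zero ∷ []) ⇓S
            ∷ [])
            (∸-computes (triangular (suc (row z))) (suc z))
        ∷ [])
        (∸-computes 1 (triangular (suc (row z)) ∸ suc z))
    ∷ ⇓π _
    ∷ [])
    (+-computes _ (row z)))

-- Antidiagonal `r` occupies the `suc r` numbers from `triangular r` on. The induction follows the
-- recursion of `row` one number at a time: the start of antidiagonal `suc r` comes right after the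
-- last entry of `r`, where the increment is 1; within an antidiagonal the increment is 0.
row-triangular : ∀ k r → k ≤ r → row (k + triangular r) ≡ r
row-triangular zero    zero    _ = refl
row-triangular zero    (suc r) _
  rewrite row-triangular r r ≤-refl | n∸n≡0 (r + triangular r) = refl
row-triangular (suc k) r       k<r
  rewrite row-triangular k r (<⇒≤ k<r)
        | m≤n⇒m∸n≡0 (m<n⇒0<n∸m (+-monoˡ-< (triangular r) k<r)) = refl

first second : ℕ → ℕ
first  z = z ∸ triangular (row z)
second z = row z ∸ first z

first-code second-code : Code 1
first-code  = comp ∸-code (π zero ∷ comp triangular-code (row-code ∷ []) ∷ [])
second-code = comp ∸-code (row-code ∷ first-code ∷ [])

first-computes : ∀ z → first-code ⟨ z ∷ [] ⟩⇓ first z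
first-computes z = ⇓comp
  (⇓π zero ∷ ⇓comp (row-computes z ∷ []) (triangular-computes (row z)) ∷ [])
  (∸-computes z (triangular (row z)))

second-computes : ∀ z → second-code ⟨ z ∷ [] ⟩⇓ second z
second-computes z = ⇓comp (row-computes z ∷ first-computes z ∷ []) (∸-computes (row z) (first z))

-- Cantor's pairing: `x + y` is the antidiagonal and `x` the offset along it.
pair : ℕ → ℕ → ℕ
pair x y = x + triangular (x + y)

first-pair : ∀ x y → first (pair x y) ≡ x
first-pair x y rewrite row-triangular x (x + y) (m≤m+n x y) = m+n∸n≡m x (triangular (x + y))

second-pair : ∀ x y → second (pair x y) ≡ y
second-pair x y rewrite first-pair x y | row-triangular x (x + y) (m≤m+n x y) = m+n∸m≡n x y

-- Tuples are coded by nested pairs. The innermost second entry is never read, so a tuple has many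
-- codes; the searches below only ask for one.
component : Fin n → ℕ → ℕ
component zero    z = first z
component (suc k) z = component k (second z)

component-code : Fin n → Code 1
component-code zero    = first-code
component-code (suc k) = comp (component-code k) (second-code ∷ [])

component-computes : ∀ (k : Fin n) z → component-code k ⟨ z ∷ [] ⟩⇓ component k z
component-computes zero    z = first-computes z
component-computes (suc k) z = ⇓comp (second-computes z ∷ []) (component-computes k (second z))

components-surjective : ∀ {n} (a : Fin n → ℕ) → ∃[ z ] ∀ k → component k z ≡ a k
components-surjective {zero}  a = 0 , λ ()
components-surjective {suc n} a with z , eqs ← components-surjective (a ∘ suc) =
  pair (a zero) z , λ where
    zero    → first-pair (a zero) z
    (suc k) → trans (cong (component k) (second-pair (a zero) z)) (eqs k)

-- Computable functions and decision procedures

-- Lets a program ignore its leading argument, the place where `μ` puts the search variable.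
tail-projections : ∀ x (xs : Vec ℕ n) →
                   Pointwise (λ g y → g ⟨ x ∷ xs ⟩⇓ y) (tabulate (π ∘ suc)) xs
tail-projections x xs =
  subst (Pointwise _ (tabulate (π ∘ suc))) (tabulate∘lookup xs) (tabulate⁺ λ k → ⇓π (suc k))

module _ {A : Pred (Vec ℕ m) 0ℓ} where

  weaken : ∀ {B} → ComputableFunction A B → ComputableFunction (A ∘ tail) B
  weaken f = record
    { code    = comp (code f) (tabulate (π ∘ suc))
    ; value   = λ xs → value f (tail xs)
    ; value∈B = λ xs → value∈B f (tail xs)
    ; halts   = λ { (x ∷ xs) a → ⇓comp (tail-projections x xs) (halts f xs a) }
    }

  project : ∀ {B : Pred ℕ 0ℓ} k → (∀ xs → A xs → B (lookup xs k)) → ComputableFunction A B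
  project k q = record
    { code    = π k
    ; value   = λ xs _ → lookup xs k
    ; value∈B = q
    ; halts   = λ _ _ → ⇓π k
    }

  component∘ : Fin n → ComputableFunction A U → ComputableFunction A U
  component∘ k f = record
    { code    = comp (component-code k) (code f ∷ [])
    ; value   = λ xs a → component k (value f xs a)
    ; value∈B = λ _ _ → tt
    ; halts   = λ xs a → ⇓comp (halts f xs a ∷ []) (component-computes k (value f xs a))
    }

Boolean : Pred ℕ 0ℓ
Boolean b = b ≡ 0 ⊎ b ≡ 1

-- Since `correct` is a disjunction, a decider also settles `P` inside the logic; this is what
-- allows a least witness to be extracted constructively.
record Decider {m} (A : Pred (Vec ℕ m) 0ℓ) (P : ∀ xs → A xs → Set p) : Set p where
  field
    decide  : ComputableFunction A Boolean
    correct : ∀ xs a → (P xs a × value decide xs a ≡ 1) ⊎ (¬ P xs a × value decide xs a ≡ 0)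

open Decider

module _ {A : Pred (Vec ℕ m) 0ℓ} where

  decide-∀ : ∀ {n} {P : Fin n → ∀ xs → A xs → Set p} →
             (∀ k → Decider A (P k)) → Decider A (λ xs a → ∀ k → P k xs a)
  decide-∀ {n = zero}  D = record
    { decide  = record
      { code    = const-code 1
      ; value   = λ _ _ → 1
      ; value∈B = λ _ _ → inj₂ refl
      ; halts   = λ xs _ → const-computes 1 xs
      }
    ; correct = λ _ _ → inj₁ ((λ ()) , refl)
    }
  decide-∀ {n = suc n} {P} D = record
    { decide  = record
      { code    = comp and-code (code f ∷ code g ∷ [])
      ; value   = λ xs a → value f xs a and value g xs a
      ; value∈B = λ xs a → [ (λ e → inj₁ (cong (_and value g xs a) e))
                           , (λ e → subst (λ b → Boolean (b and value g xs a)) (sym e) (value∈B g xs a))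
                           ]′ (value∈B f xs a)
      ; halts   = λ xs a → ⇓comp (halts f xs a ∷ halts g xs a ∷ []) (and-computes _ _)
      }
    ; correct = and-correct
    }
    where
    D′ = decide-∀ (D ∘ suc)
    f = decide (D zero)
    g = decide D′
    and-correct : ∀ xs a → ((∀ k → P k xs a) × (value f xs a and value g xs a) ≡ 1) ⊎
                           (¬ (∀ k → P k xs a) × (value f xs a and value g xs a) ≡ 0)
    and-correct xs a with correct (D zero) xs a
    ... | inj₂ (¬p , e) rewrite e = inj₂ ((λ q → ¬p (q zero)) , refl)
    ... | inj₁ (p , e) rewrite e with correct D′ xs a
    ...   | inj₁ (q , e′) = inj₁ ((λ { zero → p ; (suc k) → q k }) , e′)
    ...   | inj₂ (¬q , e′) = inj₂ ((λ q → ¬q (q ∘ suc)) , e′)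

-- Unbounded search

least : {P : ℕ → Set p} → (∀ t → P t ⊎ ¬ P t) → ∃ P → ∃[ t ] P t × (∀ {s} → s < t → ¬ P s)
-- The bound is `suc t` so that the known witness `t` itself is examined; finding nothing then
-- contradicts `pt`.
least {P = P} P? (t , pt) with below (suc t)
  where
  below : ∀ k → (∃[ t ] P t × (∀ {s} → s < t → ¬ P s)) ⊎ (∀ {s} → s < k → ¬ P s)
  below zero    = inj₂ λ ()
  below (suc k) with below k
  ... | inj₁ r = inj₁ r
  ... | inj₂ none with P? k
  ...   | inj₁ pk = inj₁ (k , pk , none)
  ...   | inj₂ ¬pk = inj₂ λ s<1+k ps → [ (λ s<k → none s<k ps) , (λ { refl → ¬pk ps }) ]′ (m≤n⇒m<n∨m≡n (s≤s⁻¹ s<1+k))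
... | inj₁ r = r
... | inj₂ none = ⊥-elim (none ≤-refl pt)

module _ {A : Pred (Vec ℕ m) 0ℓ} {P : ℕ → ∀ xs → A xs → Set p}
         (D : Decider (A ∘ tail) (λ xs → P (head xs) (tail xs)))
         (ex : ∀ xs a → ∃[ t ] P t xs a) where

  private
    minimal : ∀ xs a → ∃[ t ] P t xs a × (∀ {s} → s < t → ¬ P s xs a)
    minimal xs a = least (λ t → [ inj₁ ∘ proj₁ , inj₂ ∘ proj₁ ]′ (correct D (t ∷ xs) a)) (ex xs a)

    -- `μ` stops at the value 0, while a decider answers 1 for truth, so the answer is negated.
    -- Before the least witness the test gives 1, the successor of 0 that `⇓μ` demands.
    test : Code (suc m)
    test = comp not-code (code (decide D) ∷ [])

    test-true : ∀ t xs a → P t xs a → test ⟨ t ∷ xs ⟩⇓ 0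
    test-true t xs a q with correct D (t ∷ xs) a
    ... | inj₂ (¬q , _) = ⊥-elim (¬q q)
    ... | inj₁ (_ , e) = ⇓comp
      (subst (code (decide D) ⟨ t ∷ xs ⟩⇓_) e (halts (decide D) (t ∷ xs) a) ∷ []) not-1

    test-false : ∀ t xs a → ¬ P t xs a → test ⟨ t ∷ xs ⟩⇓ 1
    test-false t xs a ¬q with correct D (t ∷ xs) a
    ... | inj₁ (q , _) = ⊥-elim (¬q q)
    ... | inj₂ (_ , e) = ⇓comp
      (subst (code (decide D) ⟨ t ∷ xs ⟩⇓_) e (halts (decide D) (t ∷ xs) a) ∷ []) not-0

  search : ComputableFunction A U
  search = record
    { code    = μ test
    ; value   = λ xs a → proj₁ (minimal xs a)
    ; value∈B = λ _ _ → tt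
    ; halts   = λ xs a → let t , q , none = minimal xs a in
                ⇓μ (test-true t xs a q) (λ s<t → 0 , test-false _ xs a (none s<t))
    }

  search-correct : ∀ xs a → P (value search xs a) xs a
  search-correct xs a = proj₁ (proj₂ (minimal xs a))

-- Computing names of elements

-- `g` plays the role of a term whose variables range over `A`. Realizers compose like terms, so
-- programs need not be written out by hand.
record Realizer {E : Setoid c ℓ} {m} (A : Pred (Vec ℕ m) 0ℓ) (i : Indexing E)
                (g : ∀ xs → A xs → Setoid.Carrier E) : Set (c ⊔ ℓ) where
  open Setoid E using (_≈_)
  field
    name     : ComputableFunction A (dom i)
    realizes : ∀ xs a → index i (value name xs a) (value∈B name xs a) ≈ g xs a

open Realizer

module _ {E : Setoid c ℓ} {i : Indexing E} where
  private
    module E = Setoid E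

  realize-≈ : ∀ {A : Pred (Vec ℕ m) 0ℓ} {g h} → (∀ xs a → g xs a E.≈ h xs a) →
              Realizer A i g → Realizer A i h
  realize-≈ g≈h R = record
    { name     = name R
    ; realizes = λ xs a → E.trans (realizes R xs a) (g≈h xs a)
    }

  realize-weaken : ∀ {A : Pred (Vec ℕ m) 0ℓ} {g} → Realizer A i g →
                   Realizer (A ∘ tail) i (λ xs → g (tail xs))
  realize-weaken R = record
    { name     = weaken (name R)
    ; realizes = λ xs → realizes R (tail xs)
    }

  -- Some name of `e` exists by surjectivity and is built into the program; thus any fixed element,
  -- such as a basis vector, may serve as a constant.
  realize-const : ∀ {A : Pred (Vec ℕ m) 0ℓ} e → Realizer A i (λ _ _ → e)
  realize-const e = let x , d , x≈e = surjective i e in record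
    { name     = record
      { code    = const-code x
      ; value   = λ _ _ → x
      ; value∈B = λ _ _ → d
      ; halts   = λ xs _ → const-computes x xs
      }
    ; realizes = λ _ _ → x≈e
    }

  realize-variable : ∀ {A : Pred (Vec ℕ m) 0ℓ} k (q : ∀ xs → A xs → dom i (lookup xs k)) →
                     Realizer A i (λ xs a → index i (lookup xs k) (q xs a))
  realize-variable k q = record
    { name     = project k q
    ; realizes = λ _ _ → E.refl
    }

  decide-≈ : ∀ {A : Pred (Vec ℕ m) 0ℓ} {g h} → Realizer A i g → Realizer A i h →
             Decider A (λ xs a → g xs a E.≈ h xs a)
  decide-≈ {A = A} {g} {h} R R′ = record
    { decide  = record
      { code    = comp (code (eq i)) (code (name R) ∷ code (name R′) ∷ [])
      ; value   = λ xs a → value (eq i) _ (both xs a)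
      ; value∈B = λ xs a → value∈B (eq i) _ (both xs a)
      ; halts   = λ xs a → ⇓comp (halts (name R) xs a ∷ halts (name R′) xs a ∷ [])
                                 (halts (eq i) _ (both xs a))
      }
    ; correct = λ xs a →
        [ (λ (e , b) → inj₁ (E.trans (E.sym (realizes R xs a)) (E.trans e (realizes R′ xs a)) , b))
        , (λ (e , b) → inj₂ ((λ e′ → e (E.trans (realizes R xs a) (E.trans e′ (E.sym (realizes R′ xs a))))) , b))
        ]′ (eq-correct i _ _ (value∈B (name R) xs a) (value∈B (name R′) xs a))
    }
    where
    both : ∀ xs a → All (dom i) (value (name R) xs a ∷ value (name R′) xs a ∷ [])
    both xs a = value∈B (name R) xs a ∷ value∈B (name R′) xs a ∷ []

-- The second clause of `Stable` for a single sort.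
Translation : {E : Setoid c ℓ} → Indexing E → Indexing E → Set ℓ
Translation {E = E} i′ i =
  Σ[ h ∈ ComputableFunction {1} (All (dom i′)) (dom i) ]
    ∀ x (d : dom i′ x) → index i′ x d ≈ index i (value h (x ∷ []) (d ∷ [])) (value∈B h (x ∷ []) (d ∷ []))
  where open Setoid E using (_≈_)

module _ {E : Setoid c ℓ} {i′ i : Indexing E} where
  private
    module E = Setoid E

  translate : Translation i′ i → ∀ {m} {A : Pred (Vec ℕ m) 0ℓ} {g} → Realizer A i′ g → Realizer A i g
  translate (h , h-correct) R = record
    { name     = record
      { code    = comp (code h) (code (name R) ∷ [])
      ; value   = λ xs a → value h _ (value∈B (name R) xs a ∷ [])
      ; value∈B = λ xs a → value∈B h _ (value∈B (name R) xs a ∷ [])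
      ; halts   = λ xs a → ⇓comp (halts (name R) xs a ∷ []) (halts h _ (value∈B (name R) xs a ∷ []))
      }
    ; realizes = λ xs a → E.trans (E.sym (h-correct _ (value∈B (name R) xs a))) (realizes R xs a)
    }

  -- Translating means computing an `i`-name of the generic element, the one whose `i′`-name is the
  -- input.
  realizer⇒translation : Realizer (All (dom i′)) i (λ xs d → index i′ (lookup xs zero) (lookup⁺ d zero)) →
                         Translation i′ i
  realizer⇒translation R = name R , λ { x d → E.sym (realizes R (x ∷ []) (d ∷ [])) }

-- Enumerating an indexed set

module _ {E : Setoid c ℓ} (i : Indexing E) (e₀ : Setoid.Carrier E) where
  private
    module E = Setoid E

  -- A search runs through all of `ℕ`, but `dom i` may be a proper subset. Composing `index` with an
  -- enumeration of `dom i` makes every number denote an element.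
  record Enumeration : Set (lsuc 0ℓ ⊔ c ⊔ ℓ) where
    field
      element            : ℕ → E.Carrier
      element-surjective : ∀ e → ∃[ z ] element z E.≈ e
      realize-element    : ∀ {m} {A : Pred (Vec ℕ m) 0ℓ} (f : ComputableFunction A U) →
                           Realizer A i (λ xs a → element (value f xs a))

    tuples-surjective : ∀ {n} (a : Fin n → E.Carrier) → ∃[ z ] ∀ k → element (component k z) E.≈ a k
    tuples-surjective a =
      let z , eqs = components-surjective (λ k → proj₁ (element-surjective (a k)))
      in z , λ k → E.trans (E.reflexive (cong element (eqs k))) (proj₂ (element-surjective (a k)))

  enumeration : Enumeration
  enumeration with dom-enumerable i
  -- A name of `e₀` excludes an empty domain.
  ... | inj₁ empty = let x , d , _ = surjective i e₀ in ⊥-elim (empty x d)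
  ... | inj₂ (f , image) = record
    { element            = λ z → index i (value f (z ∷ []) tt) (inDom z)
    ; element-surjective = λ e →
        let x , d , x≈e = surjective i e
            z , fz≡x = Equivalence.to (image x) d
        in z , E.trans (index-≡ (inDom z) d fz≡x) x≈e
    ; realize-element    = λ g → record
      { name     = record
        { code    = comp (code f) (code g ∷ [])
        ; value   = λ xs a → value f (value g xs a ∷ []) tt
        ; value∈B = λ xs a → inDom (value g xs a)
        ; halts   = λ xs a → ⇓comp (halts g xs a ∷ []) (halts f _ tt)
        }
      ; realizes = λ _ _ → E.refl
      }
    }
    where
    inDom : ∀ z → dom i (value f (z ∷ []) tt)
    inDom z = Equivalence.from (image _) (z , refl)
    index-≡ : ∀ {x y} (d : dom i x) (d′ : dom i y) → x ≡ y → index i x d E.≈ index i y d′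
    index-≡ d d′ refl = index-unique i _ d d′

-- Computable binary operations

Realizable₂ : ∀ {E F G : Setoid c ℓ} → Indexing E → Indexing F → Indexing G →
              (Setoid.Carrier E → Setoid.Carrier F → Setoid.Carrier G) → Set (lsuc 0ℓ ⊔ c ⊔ ℓ)
Realizable₂ i j k _∙_ = ∀ {m} {A : Pred (Vec ℕ m) 0ℓ} {g h} →
  Realizer A i g → Realizer A j h → Realizer A k (λ xs a → g xs a ∙ h xs a)

module _ {n} (E : Fin n → Setoid c ℓ) (i : ∀ s → Indexing (E s)) (a b t : Fin n)
         (_∙_ : Setoid.Carrier (E a) → Setoid.Carrier (E b) → Setoid.Carrier (E t))
         (∙-cong : ∀ {x x′ y y′} → Setoid._≈_ (E a) x x′ → Setoid._≈_ (E b) y y′ →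
                   Setoid._≈_ (E t) (x ∙ y) (x′ ∙ y′)) where

  computable⇒realizable₂ : ComputableRelativelyTo E i (binary E a b t _∙_ ∙-cong) →
                           Realizable₂ (i a) (i b) (i t) _∙_
  computable⇒realizable₂ (f , f-correct) {A = A} R R′ = record
    { name     = record
      { code    = comp (code f) (code (name R) ∷ code (name R′) ∷ [])
      ; value   = λ xs d → value f _ (both xs d)
      ; value∈B = λ xs d → value∈B f _ (both xs d)
      ; halts   = λ xs d → ⇓comp (halts (name R) xs d ∷ halts (name R′) xs d ∷ [])
                                 (halts f _ (both xs d))
      }
    ; realizes = λ xs d → Setoid.trans (E t) (f-correct _ (both xs d))
                                             (∙-cong (realizes R xs d) (realizes R′ xs d))
    }
    where
    both : ∀ xs (d : A xs) → ∏ (λ k → dom (i (lookup (a ∷ b ∷ []) k)))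
                               (value (name R) xs d ∷ value (name R′) xs d ∷ [])
    both xs d zero       = value∈B (name R) xs d
    both xs d (suc zero) = value∈B (name R′) xs d

  -- Acting on realizers in every context includes acting on the two generic variables, and that
  -- instance is already the required program.
  realizable₂⇒computable : Realizable₂ (i a) (i b) (i t) _∙_ →
                           ComputableRelativelyTo E i (binary E a b t _∙_ ∙-cong)
  realizable₂⇒computable _⊙_ = name R , realizes R
    where
    R = realize-variable {i = i a} {A = ∏ (λ k → dom (i (lookup (a ∷ b ∷ []) k)))} zero (λ _ d → d zero)
      ⊙ realize-variable {i = i b} (suc zero) (λ _ d → d (suc zero))

-- Linear combinations

module _ {c ℓ} {K L : Field c ℓ} (ext : FieldExtension K L) where
  private
    module K = Field K using (Carrier; _≈_; _+_; _*_; _-_; 0#; refl; trans; +-cong; *-cong; setoid; +-abelianGroup)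
    module L = Field L using (Carrier; _≈_; _+_; _*_; 0#; refl; sym; trans; +-cong; *-cong; *-congˡ; *-congʳ; *-assoc; *-comm; distribʳ; setoid; semiring; +-abelianGroup)
    module K+ = AbelianGroupProperties K.+-abelianGroup using (x∙y⁻¹≈ε⇒x≈y; //-rightDividesˡ)
    module L+ = AbelianGroupProperties L.+-abelianGroup using (identityˡ-unique)
  open FieldExtension ext using (embed; _·_; ⟦⟧-cong; +-homo; *-homo; LinearlyIndependent; Spanning; FiniteDegree)
  open SemiringSum L.semiring using (sum; sum-cong-≋; ∑-distrib-+; *-distribˡ-sum; *-distribʳ-sum)
  open SetoidReasoning L.setoid

  combination : ∀ {n} → (Fin n → K.Carrier) → (Fin n → L.Carrier) → L.Carrier
  combination a v = sum (λ k → a k · v k)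

  combination-cong : ∀ {n} {a a′ : Fin n → K.Carrier} {v v′ : Fin n → L.Carrier} →
                     (∀ k → a k K.≈ a′ k) → (∀ k → v k L.≈ v′ k) →
                     combination a v L.≈ combination a′ v′
  combination-cong a≈a′ v≈v′ = sum-cong-≋ λ k → L.*-cong (⟦⟧-cong (a≈a′ k)) (v≈v′ k)

  combination-congˡ : ∀ {n} {a a′ : Fin n → K.Carrier} {v : Fin n → L.Carrier} →
                      (∀ k → a k K.≈ a′ k) → combination a v L.≈ combination a′ v
  combination-congˡ a≈a′ = combination-cong a≈a′ λ _ → L.refl

  combination-+ : ∀ {n} (a a′ : Fin n → K.Carrier) (v : Fin n → L.Carrier) →
                  combination (λ k → a k K.+ a′ k) v L.≈ combination a v L.+ combination a′ v
  combination-+ a a′ v = L.trans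
    (sum-cong-≋ λ k → L.trans (L.*-congʳ (+-homo (a k) (a′ k))) (L.distribʳ (v k) (embed (a k)) (embed (a′ k))))
    (∑-distrib-+ (λ k → a k · v k) (λ k → a′ k · v k))

  combination-· : ∀ {n} x (a : Fin n → K.Carrier) (v : Fin n → L.Carrier) →
                  combination (λ k → x K.* a k) v L.≈ x · combination a v
  combination-· x a v = L.trans
    (sum-cong-≋ λ k → L.trans (L.*-congʳ (*-homo x (a k))) (L.*-assoc (embed x) (embed (a k)) (v k)))
    (L.sym (*-distribˡ-sum (embed x) (λ k → a k · v k)))

  combination-*ʳ : ∀ {n} (a : Fin n → K.Carrier) (v : Fin n → L.Carrier) y →
                   combination a v L.* y L.≈ combination a (λ k → v k L.* y)
  combination-*ʳ a v y = L.trans (*-distribʳ-sum y (λ k → a k · v k)) (sum-cong-≋ λ k → L.*-assoc (embed (a k)) (v k) y)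

  combination-*ˡ : ∀ {n} x (a : Fin n → K.Carrier) (v : Fin n → L.Carrier) →
                   x L.* combination a v L.≈ combination a (λ k → x L.* v k)
  combination-*ˡ x a v = begin
    x L.* combination a v              ≈⟨ L.*-comm x _ ⟩
    combination a v L.* x              ≈⟨ combination-*ʳ a v x ⟩
    combination a (λ k → v k L.* x)    ≈⟨ combination-cong (λ _ → K.refl) (λ k → L.*-comm (v k) x) ⟩
    combination a (λ k → x L.* v k)    ∎

  -- The differences `a k - a′ k` have a combination which, added to that of `a′`, gives that of
  -- `a`, hence that of `a′` again. By cancellation it is 0, and independence applies.
  combination-injective : ∀ {n} {v : Fin n → L.Carrier} → LinearlyIndependent v →
                          ∀ {a a′} → combination a v L.≈ combination a′ v → ∀ k → a k K.≈ a′ k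
  combination-injective {v = v} independent {a} {a′} e k =
    K+.x∙y⁻¹≈ε⇒x≈y _ _ (independent (λ k → a k K.- a′ k) (L+.identityˡ-unique _ _ difference+) k)
    where
    difference+ : combination (λ k → a k K.- a′ k) v L.+ combination a′ v L.≈ combination a′ v
    difference+ = begin
      combination (λ k → a k K.- a′ k) v L.+ combination a′ v ≈⟨ combination-+ _ a′ v ⟨
      combination (λ k → (a k K.- a′ k) K.+ a′ k) v           ≈⟨ combination-congˡ (λ k → K+.//-rightDividesˡ (a′ k) (a k)) ⟩
      combination a v                                         ≈⟨ e ⟩
      combination a′ v                                        ∎

  module _ {iK : Indexing K.setoid} {iL : Indexing L.setoid}
           (_⊕_ : Realizable₂ iL iL iL L._+_) (_⊙_ : Realizable₂ iK iL iL _·_) where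

    -- The number of terms is fixed in advance: the recursion on `n` builds the program and is not
    -- performed by it.
    realize-combination : ∀ {m n} {A : Pred (Vec ℕ m) 0ℓ}
      {a : Fin n → ∀ xs → A xs → K.Carrier} {v : Fin n → ∀ xs → A xs → L.Carrier} →
      (∀ k → Realizer A iK (a k)) → (∀ k → Realizer A iL (v k)) →
      Realizer A iL (λ xs d → combination (λ k → a k xs d) (λ k → v k xs d))
    realize-combination {n = zero}  Ra Rv = realize-const L.0#
    realize-combination {n = suc n} Ra Rv =
      (Ra zero ⊙ Rv zero) ⊕ realize-combination (Ra ∘ suc) (Rv ∘ suc)

  -- Indexing L by coordinates

  module CoordinateIndexing (iK : Indexing K.setoid) {n} (b : Fin n → L.Carrier)
                            (independent : LinearlyIndependent b) (spanning : Spanning b) where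
    open Enumeration (enumeration iK K.0#)

    coordinate : ℕ → Fin n → K.Carrier
    coordinate z k = element (component k z)

    realize-coordinate : ∀ {m} {A : Pred (Vec ℕ m) 0ℓ} (f : ComputableFunction A U) k →
                         Realizer A iK (λ xs d → coordinate (value f xs d) k)
    realize-coordinate f k = realize-element (component∘ k f)

    denotation : ℕ → L.Carrier
    denotation z = combination (coordinate z) b

    private
      decide-equal : Decider {m = 2} (All U) (λ xs _ → ∀ k → coordinate (lookup xs zero) k K.≈ coordinate (lookup xs (suc zero)) k)
      decide-equal = decide-∀ λ k → decide-≈ (realize-coordinate (project zero (λ _ _ → tt)) k)
                                             (realize-coordinate (project (suc zero) (λ _ _ → tt)) k)

    iL : Indexing L.setoid
    iL = record
      { dom            = U
      ; index          = λ z _ → denotation z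
      ; index-unique   = λ _ _ _ → L.refl
      ; dom-enumerable = inj₂ (project zero (λ _ _ → tt) , λ y → mk⇔ (λ _ → y , refl) (λ _ → tt))
      ; surjective     = λ x →
          let a , x≈ = spanning x
              z , z≈ = tuples-surjective a
          in z , tt , L.trans (combination-congˡ z≈) (L.sym x≈)
      ; eq             = decide decide-equal
      ; eq-correct     = λ x y dx dy →
          [ (λ (e , q) → inj₁ (combination-congˡ e , q))
          -- The program compares coordinates; independence ensures that different coordinates
          -- denote different elements.
          , (λ (e , q) → inj₂ (e ∘ combination-injective independent , q))
          ]′ (correct decide-equal (x ∷ y ∷ []) (dx ∷ dy ∷ []))
      }

    module _ {m} {A : Pred (Vec ℕ m) 0ℓ} {a : Fin n → ∀ xs → A xs → K.Carrier}
             (R : ∀ k → Realizer A iK (a k)) where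
      private
        matches : ℕ → ∀ xs → A xs → Set ℓ
        matches z xs d = ∀ k → coordinate z k K.≈ a k xs d

        decide-matches : Decider (A ∘ tail) (λ xs → matches (head xs) (tail xs))
        decide-matches = decide-∀ λ k →
          -- `lookup xs zero` and `head xs` agree only once the vector is split.
          decide-≈ (realize-≈ (λ { (_ ∷ _) _ → K.refl }) (realize-coordinate (project zero (λ _ _ → tt)) k))
                   (realize-weaken (R k))

        exists : ∀ xs d → ∃[ z ] matches z xs d
        exists xs d = tuples-surjective (λ k → a k xs d)

      -- The given `iK`-names say nothing about where the elements occur in the enumeration, so a
      -- tuple code is found by search.
      realize-by-coordinates : Realizer A iL (λ xs d → combination (λ k → a k xs d) b)
      realize-by-coordinates = record
        { name     = search decide-matches exists
        ; realizes = λ xs d → combination-congˡ (search-correct decide-matches exists xs d)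
        }

    module _ (_⊕_ : Realizable₂ iK iK iK K._+_) (_⊗_ : Realizable₂ iK iK iK K._*_) where

      realize-+ : Realizable₂ iL iL iL L._+_
      realize-+ R R′ = realize-≈
        (λ xs d → L.trans (combination-+ _ _ b) (L.+-cong (realizes R xs d) (realizes R′ xs d)))
        (realize-by-coordinates λ k → realize-coordinate (name R) k ⊕ realize-coordinate (name R′) k)

      realize-· : Realizable₂ iK iL iL _·_
      realize-· R R′ = realize-≈
        (λ xs d → L.trans (combination-· _ _ b) (L.*-congˡ (realizes R′ xs d)))
        (realize-by-coordinates λ k → R ⊗ realize-coordinate (name R′) k)

      -- By bilinearity a product is a double combination of the constants `b k * b l`, which the
      -- two preceding operations compute.
      realize-* : Realizable₂ iL iL iL L._*_
      realize-* R R′ = realize-≈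
        (λ xs d → L.trans
          (L.trans (combination-cong (λ _ → K.refl) (λ k → L.sym (combination-*ˡ (b k) _ b)))
                   (L.sym (combination-*ʳ _ b _)))
          (L.*-cong (realizes R xs d) (realizes R′ xs d)))
        (realize-combination realize-+ realize-· (realize-coordinate (name R)) λ k →
         realize-combination realize-+ realize-· (realize-coordinate (name R′)) λ l →
         realize-const (b k L.* b l))

  -- The two halves of stability

  private
    M = extensionStructure ext
    open Structure M using (carrier)

    k l : Fin 2
    k = zero
    l = suc zero

    ·-cong : ∀ {a a′ x x′} → a K.≈ a′ → x L.≈ x′ → a · x L.≈ a′ · x′
    ·-cong a≈a′ = L.*-cong (⟦⟧-cong a≈a′)

    K-carrier : Fin 1 → Setoid c ℓ
    K-carrier _ = K.setoid

  extension-indexing : ∃ (Admissible (fieldStructure K)) → FiniteDegree → ∃ (Admissible M)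
  extension-indexing (i , adm) (n , b , independent , spanning) = j , λ where
      zero                         → realizable₂⇒computable carrier j k k k K._+_ K.+-cong add
      (suc zero)                   → realizable₂⇒computable carrier j k k k K._*_ K.*-cong mul
      (suc (suc zero))             → realizable₂⇒computable carrier j l l l L._+_ L.+-cong (realize-+ add mul)
      (suc (suc (suc zero)))       → realizable₂⇒computable carrier j k l l _·_ ·-cong (realize-· add mul)
      (suc (suc (suc (suc zero)))) → realizable₂⇒computable carrier j l l l L._*_ L.*-cong (realize-* add mul)
    where
    open CoordinateIndexing (i zero) b independent spanning
    add : Realizable₂ (i zero) (i zero) (i zero) K._+_
    add = computable⇒realizable₂ K-carrier i zero zero zero K._+_ K.+-cong (adm zero)
    mul : Realizable₂ (i zero) (i zero) (i zero) K._*_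
    mul = computable⇒realizable₂ K-carrier i zero zero zero K._*_ K.*-cong (adm (suc zero))
    j : StructureIndexing M
    j zero       = i zero
    j (suc zero) = iL

  module _ (j : StructureIndexing M) (adm : Admissible M j) where

    -- Makes the stability of `K` applicable to the first sort. The detour through realizers is
    -- taken because the two `∏` domains agree only after a case split on the argument position.
    restrict-admissible : Admissible (fieldStructure K) (λ _ → j k)
    restrict-admissible zero       = realizable₂⇒computable K-carrier (λ _ → j k) zero zero zero K._+_ K.+-cong
      (computable⇒realizable₂ carrier j k k k K._+_ K.+-cong (adm zero))
    restrict-admissible (suc zero) = realizable₂⇒computable K-carrier (λ _ → j k) zero zero zero K._*_ K.*-cong
      (computable⇒realizable₂ carrier j k k k K._*_ K.*-cong (adm (suc zero)))

    -- Valid for an arbitrary admissible indexing: it serves `j′` when candidates are tested and `j`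
    -- when the answer is assembled.
    admissible-combination : ∀ {m n} {A : Pred (Vec ℕ m) 0ℓ} (b : Fin n → L.Carrier)
      {a : Fin n → ∀ xs → A xs → K.Carrier} → (∀ k → Realizer A (j zero) (a k)) →
      Realizer A (j l) (λ xs d → combination (λ k → a k xs d) b)
    admissible-combination b R = realize-combination
      (computable⇒realizable₂ carrier j l l l L._+_ L.+-cong (adm (suc (suc zero))))
      (computable⇒realizable₂ carrier j k l l _·_ ·-cong (adm (suc (suc (suc zero)))))
      R (λ k → realize-const (b k))

  module _ {n} {b : Fin n → L.Carrier} (spanning : Spanning b)
           (j j′ : StructureIndexing M) (adm : Admissible M j) (adm′ : Admissible M j′) where
    private
      open Enumeration (enumeration (j′ k) K.0#)

      A : Pred (Vec ℕ 1) 0ℓ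
      A = All (dom (j′ l))

      given : ∀ xs → A xs → L.Carrier
      given xs d = index (j′ l) (lookup xs zero) (lookup⁺ d zero)

      denotation : ℕ → L.Carrier
      denotation z = combination (λ k → element (component k z)) b

      -- Both sides have computable `j′ l`-names, so the equality program of `j′ l` decides this.
      decide-denotes : Decider (A ∘ tail) (λ xs d → denotation (head xs) L.≈ given (tail xs) d)
      decide-denotes = decide-≈
        (realize-≈ (λ { (_ ∷ _) _ → L.refl })
          (admissible-combination j′ adm′ b λ k → realize-element (component∘ k (project zero (λ _ _ → tt)))))
        (realize-weaken {g = given} (realize-variable zero (λ xs d → lookup⁺ {xs = xs} d zero)))

      denotes : ∀ xs d → ∃[ z ] denotation z L.≈ given xs d
      denotes xs d =
        let a , x≈ = spanning (given xs d)
            z , z≈ = tuples-surjective a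
        in z , L.trans (combination-congˡ z≈) (L.sym x≈)

    -- Only scalars are translated; the basis vectors receive fixed names in `j l`. The element
    -- denoted is unchanged, so the correctness of the search in `j′` carries over to `j`.
    extension-translation : Translation (j′ k) (j k) → Translation (j′ l) (j l)
    extension-translation h = realizer⇒translation {i′ = j′ l} (realize-≈
      (search-correct decide-denotes denotes)
      (admissible-combination j adm b λ k →
        translate h (realize-element (component∘ k (search decide-denotes denotes)))))

proposition10 : ∀ {c ℓ} (K L : Field c ℓ) → Stable (fieldStructure K) →
    (ext : FieldExtension K L) → FieldExtension.FiniteDegree ext →
    Stable (extensionStructure ext)
proposition10 K L (indexable , unique) ext degree@(n , b , _ , spanning) =
  extension-indexing ext indexable degree , λ where
    j j′ adm adm′ zero       → K-translation j j′ adm adm′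
    j j′ adm adm′ (suc zero) →
      extension-translation ext spanning j j′ adm adm′ (K-translation j j′ adm adm′)
  where
  K-translation : ∀ j j′ → Admissible (extensionStructure ext) j → Admissible (extensionStructure ext) j′ →
                  Translation (j′ zero) (j zero)
  K-translation j j′ adm adm′ = unique (λ _ → j zero) (λ _ → j′ zero)
    (restrict-admissible ext j adm) (restrict-admissible ext j′ adm′) zero
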